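{- Let $\chi:A\to\nabla_0B$ be an oracle with $B$ $\neg\neg$-separated. Then for every type $X:\mathcal{U}$ there is a unique map $\mathtt{erase}:\bigcirc_\chi X\to\nabla_0X$ with $\mathtt{erase}\circ\eta_X=\iota_X$, where $\eta_X:X\to\bigcirc_\chi X$ is the unit of $\bigcirc_\chi$ and $\iota_X:X\to\nabla_0X$ the unit of $\nabla_0$.
   Context: Setting: homotopy type theory with a univalent universe $\mathcal{U}$ of small types and higher inductive types. It is assumed that there is a small type $\Omega_{\neg\neg}:\mathcal{U}$ classifying $\neg\neg$-stable propositions (each element is a $\neg\neg$-stable proposition, and every $\neg\neg$-stable proposition is given by a unique element). A type $X$ is $\neg\neg$-separated if $\neg\neg(x=y)\to x=y$ for all $x,y:X$. For a type $X$, $\nabla_0X$ is the type of $\xi:X\to\Omega_{\neg\neg}$ such that $\neg\neg\sum_{x:X}\xi(x)$ and $\prod_{x,y:X}\xi(x)\to\xi(y)\to\neg\neg(x=y)$; write $\xi\downarrow:=\sum_{x:X}\xi(x)$. The unit $\iota_X$ sends $x$ to $\lambda y.\neg\neg(x=y)$; $\nabla_0$ is a higher modality. For a family $B:A\to\mathcal{U}$, the nullification at $B$ is the higher modality whose modal types are exactly the $X$ such that for every $a$ the constant map $X\to X^{B(a)}$ is an equivalence. An oracle is a map $\chi:A\to\nabla_0B$; the oracle modality $\bigcirc_\chi$ is the nullification at the family $a\mapsto\chi(a)\downarrow$. -}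

{-# OPTIONS --without-K #-}
module Defs where

open import Axiom.Extensionality.Propositional using (Extensionality; lower-extensionality)
open import Data.Empty using (⊥-elim)
open import Data.Product using (Σ; Σ-syntax; _×_; _,_; proj₁; proj₂)
open import Function using (_∘_; const; _⇔_)
open import Level using (Level; _⊔_; suc)
open import Relation.Binary.PropositionalEquality using (_≡_; refl; sym; trans)
open import Relation.Nullary using (¬_; Irrelevant; Stable)
open import Relation.Nullary.Negation using (negated-stable)

private
  variable
    a b ℓ : Level

-- Throughout, a universe of the ambient type theory is Set ℓ, `Irrelevant` is
-- "is a (mere) proposition" and `Stable` is "is ¬¬-stable".  Axiom K must stay
-- off: the types below are arbitrary, not sets.

isContr : Set a → Set a
isContr A = Σ[ c ∈ A ] (∀ x → c ≡ x)

isEquiv : {A : Set a} {B : Set b} → (A → B) → Set (a ⊔ b)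
isEquiv {A = A} f = ∀ y → isContr (Σ[ x ∈ A ] (f x ≡ y))

infix 4 _≃_
_≃_ : Set a → Set b → Set (a ⊔ b)
A ≃ B = Σ[ f ∈ (A → B) ] isEquiv f

¬¬-Separated : Set a → Set a
¬¬-Separated X = (x y : X) → Stable (x ≡ y)

-- A small type Ω¬¬ classifying ¬¬-stable propositions.  Uniqueness of the name
-- of P is expressed with El ω ≃ P, which under univalence is El ω ≡ P.
record ¬¬-Classifier (ℓ : Level) : Set (suc ℓ) where
  field
    Ω¬¬           : Set ℓ
    El            : Ω¬¬ → Set ℓ
    El-irrelevant : ∀ ω → Irrelevant (El ω)
    El-stable     : ∀ ω → Stable (El ω)
    classify      : (P : Set ℓ) → Irrelevant P → Stable P →
                    isContr (Σ[ ω ∈ Ω¬¬ ] (El ω ≃ P))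

  ⌜_⌝ : (P : Set ℓ) → Irrelevant P → Stable P → Ω¬¬
  ⌜ P ⌝ irr st = proj₁ (proj₁ (classify P irr st))

  module _ {P : Set ℓ} (irr : Irrelevant P) (st : Stable P) where

    ⌜⌝-out : El (⌜ P ⌝ irr st) → P
    ⌜⌝-out = proj₁ (proj₂ (proj₁ (classify P irr st)))

    ⌜⌝-in : P → El (⌜ P ⌝ irr st)
    ⌜⌝-in p = proj₁ (proj₁ (proj₂ (proj₂ (proj₁ (classify P irr st))) p))

module Nabla (C : ¬¬-Classifier ℓ) where
  open ¬¬-Classifier C

  ∇₀ : Set ℓ → Set ℓ
  ∇₀ X = Σ[ ξ ∈ (X → Ω¬¬) ]
           (¬ ¬ (Σ[ x ∈ X ] El (ξ x)))
         × ((x y : X) → El (ξ x) → El (ξ y) → ¬ ¬ (x ≡ y))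

  infix 5 _↓
  _↓ : {X : Set ℓ} → ∇₀ X → Set ℓ
  _↓ {X} ξ = Σ[ x ∈ X ] El (proj₁ ξ x)

  -- Function extensionality makes ¬ ¬ (x ≡ y) a proposition, so that it has a
  -- name in Ω¬¬.
  module Unit (funext : Extensionality ℓ ℓ) where

    ¬¬-irrelevant : {P : Set ℓ} → Irrelevant (¬ ¬ P)
    ¬¬-irrelevant f g =
      lower-extensionality ℓ ℓ funext (λ ¬p → ⊥-elim (f ¬p))

    ⌜¬¬_⌝ : Set ℓ → Ω¬¬
    ⌜¬¬ P ⌝ = ⌜ ¬ ¬ P ⌝ ¬¬-irrelevant negated-stable

    ι : (X : Set ℓ) → X → ∇₀ X
    ι X x = (λ y → ⌜¬¬ (x ≡ y) ⌝) , inhabited , unique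
      where
      out : ∀ {y} → El ⌜¬¬ (x ≡ y) ⌝ → ¬ ¬ (x ≡ y)
      out = ⌜⌝-out ¬¬-irrelevant negated-stable

      inhabited : ¬ ¬ (Σ[ y ∈ X ] El ⌜¬¬ (x ≡ y) ⌝)
      inhabited k = k (x , ⌜⌝-in ¬¬-irrelevant negated-stable (λ ¬p → ¬p refl))

      unique : ∀ y z → El ⌜¬¬ (x ≡ y) ⌝ → El ⌜¬¬ (x ≡ z) ⌝ → ¬ ¬ (y ≡ z)
      unique y z p q ¬r = out p (λ s → out q (λ t → ¬r (trans (sym s) t)))

-- Higher modalities in the sense of Rijke–Shulman–Spitters.
record HigherModality (ℓ : Level) : Set (suc ℓ) where
  field
    ○        : Set ℓ → Set ℓ
    η        : (X : Set ℓ) → X → ○ X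
    ind      : {X : Set ℓ} (P : ○ X → Set ℓ) →
               ((x : X) → ○ (P (η X x))) → (z : ○ X) → ○ (P z)
    ind-η    : {X : Set ℓ} (P : ○ X → Set ℓ) (f : (x : X) → ○ (P (η X x))) →
               (x : X) → ind P f (η X x) ≡ f x
    ≡-modal  : {X : Set ℓ} (x y : ○ X) → isEquiv (η (x ≡ y))

  isModal : Set ℓ → Set ℓ
  isModal X = isEquiv (η X)

isNull : {A : Set ℓ} (B : A → Set ℓ) → Set ℓ → Set ℓ
isNull {A = A} B X = (a : A) → isEquiv (const {A = X} {B = B a})

-- Without higher inductive types the nullification at B is specified by its
-- defining property instead of being constructed.
isNullificationAt : {A : Set ℓ} (B : A → Set ℓ) → HigherModality ℓ → Set (suc ℓ)
isNullificationAt B M = ∀ X → HigherModality.isModal M X ⇔ isNull B X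

module _ (C : ¬¬-Classifier ℓ) where
  open Nabla C

  -- M is the oracle modality ○_χ of the oracle χ.
  isOracleModality : {A B : Set ℓ} → (A → ∇₀ B) → HigherModality ℓ → Set (suc ℓ)
  isOracleModality χ M = isNullificationAt (λ a → χ a ↓) M

{-# OPTIONS --without-K #-}

-- Since B is ¬¬-separated, each χ(a)↓ is a proposition P with ¬¬P.  Any
-- f : P → ∇₀ X then glues to the single predicate λ x → ∀ p → El (f p x), and
-- ∇₀ X is ¬¬-separated, so ∇₀ X is null at P and hence modal for ○_χ.  The
-- universal property of the unit of ○_χ extends ι uniquely; the witnesses of
-- commutation agree because ¬¬-separated types are sets (Hedberg).

module Submission where

open import Defs
open import Axiom.Extensionality.Propositional using (Extensionality)
open import Axiom.UniquenessOfIdentityProofs using (UIP; module Constant⇒UIP)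
open import Data.Product using (Σ-syntax; _,_; proj₁; proj₂)
open import Function using (_∘_; const; module Equivalence)
open import Level using (Level)
open import Relation.Binary.PropositionalEquality
  using (_≡_; refl; sym; trans; cong; cong-app; subst)
open import Relation.Nullary using (¬_; Irrelevant; Stable)
open import Relation.Nullary.Negation using (¬¬-map)

private
  variable
    ℓ : Level

Σ-≡-irrelevant : {A : Set ℓ} {B : A → Set ℓ} → (∀ x → Irrelevant (B x)) →
                 {u v : Σ[ x ∈ A ] B x} → proj₁ u ≡ proj₁ v → u ≡ v
Σ-≡-irrelevant irr {x , _} refl = cong (x ,_) (irr x _ _)

Irrelevant-⇔⇒≃ : {P Q : Set ℓ} → Irrelevant P → Irrelevant Q →
                 (P → Q) → (Q → P) → P ≃ Q
Irrelevant-⇔⇒≃ irrP irrQ f g = f , λ y →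
  (g y , irrQ _ _) , λ _ → Σ-≡-irrelevant (λ _ → set) (irrP _ _)
  where
  -- Propositions are sets: `irrQ` yields a path that ignores the given one, hence a constant
  -- endomap of each identity type.
  set = Constant⇒UIP.≡-irrelevant (λ _ → irrQ _ _) (λ _ _ → refl)

isEquiv⇒injective : {A B : Set ℓ} {f : A → B} → isEquiv f →
                    ∀ {x y} → f x ≡ f y → x ≡ y
isEquiv⇒injective {f = f} e {x} {y} p =
  trans (sym (cong proj₁ (proj₂ (e (f y)) (x , p))))
        (cong proj₁ (proj₂ (e (f y)) (y , refl)))

module _ (M : HigherModality ℓ) where
  open HigherModality M

  module _ {X Y : Set ℓ} (mY : isModal Y) where

    ○-rec : (X → Y) → ○ X → Y
    ○-rec f z = proj₁ (proj₁ (mY (ind (λ _ → Y) (η Y ∘ f) z)))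

    ○-rec-η : (f : X → Y) → ∀ x → ○-rec f (η X x) ≡ f x
    ○-rec-η f x = isEquiv⇒injective mY
      (trans (proj₂ (proj₁ (mY _))) (ind-η (λ _ → Y) (η Y ∘ f) x))

    -- `≡-modal` speaks of identity types in `○ Y`, so the induction proves `η Y (g w) ≡ η Y (h w)`;
    -- injectivity of `η Y` then removes the unit.
    ○-ext : (g h : ○ X → Y) → (∀ x → g (η X x) ≡ h (η X x)) → ∀ z → g z ≡ h z
    ○-ext g h p z = isEquiv⇒injective mY
      (proj₁ (proj₁ (≡-modal (η Y (g z)) (η Y (h z))
        (ind (λ w → η Y (g w) ≡ η Y (h w))
             (λ x → η _ (cong (η Y) (p x))) z))))

module _ (funext : Extensionality ℓ ℓ) (C : ¬¬-Classifier ℓ) where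
  open ¬¬-Classifier C
  open Nabla C
  open Unit funext

  Π-irrelevant : {A : Set ℓ} {B : A → Set ℓ} →
                 (∀ x → Irrelevant (B x)) → Irrelevant (∀ x → B x)
  Π-irrelevant irr f g = funext (λ x → irr x (f x) (g x))

  Π-stable : {A : Set ℓ} {B : A → Set ℓ} →
             (∀ x → Stable (B x)) → Stable (∀ x → B x)
  Π-stable st ¬¬f x = st x (¬¬-map (λ f → f x) ¬¬f)

  -- Hedberg's argument: `sep` makes an endomap of `x ≡ y` that factors through the proposition
  -- `¬ ¬ (x ≡ y)`, so it is constant.
  ¬¬-Separated⇒UIP : {X : Set ℓ} → ¬¬-Separated X → UIP X
  ¬¬-Separated⇒UIP sep = Constant⇒UIP.≡-irrelevant
    (λ p → sep _ _ (λ ¬p → ¬p p))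
    (λ _ _ → cong (sep _ _) (¬¬-irrelevant _ _))

  Π-¬¬-Separated : {A X : Set ℓ} → ¬¬-Separated X → ¬¬-Separated (A → X)
  Π-¬¬-Separated sep f g ¬¬p =
    funext (λ x → sep (f x) (g x) (¬¬-map (λ p → cong-app p x) ¬¬p))

  -- Both `ω` and `ω′` name `El ω′`, and the type of its names is contractible.
  El-injective : ∀ {ω ω′} → (El ω → El ω′) → (El ω′ → El ω) → ω ≡ ω′
  El-injective {ω} {ω′} f g = trans
    (sym (cong proj₁ (centre (ω , Irrelevant-⇔⇒≃ irr irr′ f g))))
    (cong proj₁ (centre (ω′ , Irrelevant-⇔⇒≃ irr′ irr′ (λ e → e) (λ e → e))))
    where
    irr    = El-irrelevant ω
    irr′   = El-irrelevant ω′
    centre = proj₂ (classify (El ω′) irr′ (El-stable ω′))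

  Ω¬¬-¬¬-Separated : ¬¬-Separated Ω¬¬
  Ω¬¬-¬¬-Separated ω ω′ ¬¬p = El-injective
    (λ e → El-stable ω′ (¬¬-map (λ p → subst El p e) ¬¬p))
    (λ e → El-stable ω (¬¬-map (λ p → subst El (sym p) e) ¬¬p))

  ∇₀-≡ : {X : Set ℓ} {ξ ζ : ∇₀ X} → proj₁ ξ ≡ proj₁ ζ → ξ ≡ ζ
  ∇₀-≡ = Σ-≡-irrelevant λ _ → λ where
    (_ , u) (_ , v) → Σ-≡-irrelevant
      (λ _ → Π-irrelevant λ _ → Π-irrelevant λ _ →
             Π-irrelevant λ _ → Π-irrelevant λ _ → ¬¬-irrelevant)
      (¬¬-irrelevant _ _)

  ∇₀-¬¬-Separated : {X : Set ℓ} → ¬¬-Separated (∇₀ X)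
  ∇₀-¬¬-Separated ξ ζ ¬¬p = ∇₀-≡
    (Π-¬¬-Separated Ω¬¬-¬¬-Separated _ _ (¬¬-map (cong proj₁) ¬¬p))

  -- The one use of separation of `B`: `unique` identifies two points only up to double negation.
  ↓-irrelevant : {B : Set ℓ} → ¬¬-Separated B → (ξ : ∇₀ B) → Irrelevant (ξ ↓)
  ↓-irrelevant sep (ξ , _ , unique) (b , e) (b′ , e′) =
    Σ-≡-irrelevant (λ x → El-irrelevant (ξ x)) (sep b b′ (unique b b′ e e′))

  module _ {P X : Set ℓ} (irr : Irrelevant P) (¬¬P : ¬ ¬ P) where

    glue : (P → ∇₀ X) → ∇₀ X
    glue f = ξ , inhabited , unique
      where
      -- A product over `P`, unlike a sum, inherits stability from its values even when `P` itself
      -- is not stable.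
      Q : X → Set ℓ
      Q x = (p : P) → El (proj₁ (f p) x)

      Q-irrelevant : ∀ x → Irrelevant (Q x)
      Q-irrelevant x = Π-irrelevant (λ _ → El-irrelevant _)

      Q-stable : ∀ x → Stable (Q x)
      Q-stable x = Π-stable (λ _ → El-stable _)

      ξ : X → Ω¬¬
      ξ x = ⌜ Q x ⌝ (Q-irrelevant x) (Q-stable x)

      out : ∀ {x} → El (ξ x) → Q x
      out {x} = ⌜⌝-out (Q-irrelevant x) (Q-stable x)

      inhabited : ¬ ¬ (Σ[ x ∈ X ] El (ξ x))
      -- The goal is a negation, so `¬¬P` may supply an actual `p`. A witness for `f p` then serves
      -- every `q`, by transport along `irr p q`.
      inhabited k = ¬¬P λ p → proj₁ (proj₂ (f p)) λ where
        (x , e) → k (x , ⌜⌝-in (Q-irrelevant x) (Q-stable x)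
          (λ q → subst (λ r → El (proj₁ (f r) x)) (irr p q) e))

      unique : ∀ x y → El (ξ x) → El (ξ y) → ¬ ¬ (x ≡ y)
      unique x y d e ¬q =
        ¬¬P λ p → proj₂ (proj₂ (f p)) x y (out d p) (out e p) ¬q

    -- Once a point `p` is given, the product over `P` is equivalent to its value at `p`: evaluate
    -- one way, transport along `irr` the other way.
    glue-const : (f : P → ∇₀ X) → const (glue f) ≡ f
    glue-const f = funext λ p → ∇₀-≡ (funext λ x → El-injective
      (λ e → ⌜⌝-out _ _ e p)
      (λ e → ⌜⌝-in _ _
        (λ q → subst (λ r → El (proj₁ (f r) x)) (irr p q) e)))

    ∇₀-null : isEquiv (const {A = ∇₀ X} {B = P})
    ∇₀-null f = (glue f , glue-const f) , λ where
      (ξ , p) → Σ-≡-irrelevant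
        (λ _ → ¬¬-Separated⇒UIP (Π-¬¬-Separated ∇₀-¬¬-Separated))
        -- Evaluating the two paths at a point of `P` gives `glue f ≡ ξ`. Only `¬¬P` is available,
        -- but this equality is stable.
        (∇₀-¬¬-Separated _ _
          (¬¬-map (cong-app (trans (glue-const f) (sym p))) ¬¬P))

mainTheorem5 :
    {ℓ : Level} (funext : Extensionality ℓ ℓ) (C : ¬¬-Classifier ℓ) →
    let open Nabla C
        open Unit funext
    in {A B : Set ℓ} (χ : A → ∇₀ B) → ¬¬-Separated B →
       (○χ : HigherModality ℓ) → isOracleModality C χ ○χ →
       let open HigherModality ○χ
       in (X : Set ℓ) → isContr (Σ[ erase ∈ (○ X → ∇₀ X) ] (erase ∘ η X ≡ ι X))
mainTheorem5 funext C χ sepB ○χ isOracle X =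
  (○-rec ○χ modal (ι X) , funext (○-rec-η ○χ modal (ι X))) , λ where
    (g , p) → Σ-≡-irrelevant
      (λ _ → ¬¬-Separated⇒UIP funext C
               (Π-¬¬-Separated funext C (∇₀-¬¬-Separated funext C)))
      (funext (○-ext ○χ modal _ g λ x →
        trans (○-rec-η ○χ modal (ι X) x) (sym (cong-app p x))))
  where
  open Nabla C
  open Unit funext
  modal : HigherModality.isModal ○χ (∇₀ X)
  modal = Equivalence.from (isOracle (∇₀ X)) λ a →
    -- The second component of the oracle value supplies the double-negated point of `χ a ↓`.
    ∇₀-null funext C (↓-irrelevant funext C sepB (χ a)) (proj₁ (proj₂ (χ a)))
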